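{- Let $\Omega$ be an atomless Borel probability space with measure $\nu$ and let $W:\Omega^2\to[0,1]$ be a graphon. Then every extreme point $\mathfrak c$ of the set $\mathrm{FCOV}(W)$ of all fractional vertex covers of $W$ is half-integral, i.e. $\mathfrak c(x)\in\{0,\tfrac12,1\}$ for almost every $x\in\Omega$.
   Context: A graphon is a symmetric measurable function $W:\Omega^2\to[0,1]$. Write $\operatorname{supp} W=\{(x,y): W(x,y)>0\}$. A fractional vertex cover of $W$ is a function $\mathfrak c\in L^\infty(\Omega)$ such that $0\le\mathfrak c\le 1$ almost everywhere and the set $\operatorname{supp}W\setminus\{(x,y):\mathfrak c(x)+\mathfrak c(y)\ge 1\}$ has $\nu^{\otimes 2}$-measure $0$. $\mathrm{FCOV}(W)\subseteq L^\infty(\Omega)$ is the (convex) set of all fractional vertex covers of $W$. A point $x$ of a convex set $X$ is extreme if the only pair $x',x''\in X$ with $x=\frac12(x'+x'')$ is $x'=x''=x$. -}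

module Defs where

open import Algebra.Bundles using (CommutativeRing)
open import Data.Fin.Base using (toℕ)
open import Data.Nat.Base as ℕ using (ℕ)
open import Data.Product.Base using (_×_; _,_; proj₁; proj₂; ∃; ∃₂; ∃-syntax)
open import Data.Sum.Base using (_⊎_)
open import Level using (0ℓ; suc)
open import Relation.Binary.Core using (Rel)
open import Relation.Binary.Definitions using (tri<; tri≈; tri>)
open import Relation.Binary.PropositionalEquality.Core using (_≢_)
open import Relation.Binary.Structures using (IsStrictTotalOrder)
open import Relation.Nullary.Negation.Core using (¬_)
open import Relation.Unary
  using (Pred; _∈_; _⊆_; _≐_; _∩_; ∁; ∅; U; ⋃; Satisfiable; Empty; _⟨×⟩_; _⊢_)

-- The real numbers, axiomatised as a Dedekind-complete ordered field; these
-- axioms determine ℝ up to a unique isomorphism.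
record Reals : Set₁ where
  field
    commutativeRing : CommutativeRing 0ℓ 0ℓ
  open CommutativeRing commutativeRing public

  infix 4 _<_ _≤_
  infix 8 _⁻¹
  field
    _<_                : Rel Carrier 0ℓ
    isStrictTotalOrder : IsStrictTotalOrder _≈_ _<_
    -- The value of 0# ⁻¹ is left unspecified.
    _⁻¹                : Carrier → Carrier
    *-inverseʳ         : ∀ x → ¬ (x ≈ 0#) → x * x ⁻¹ ≈ 1#
    0<1                : 0# < 1#
    +-monoˡ-<          : ∀ {x y} z → x < y → x + z < y + z
    *-pos              : ∀ {x y} → 0# < x → 0# < y → 0# < x * y

  _≤_ : Rel Carrier 0ℓ
  x ≤ y = x < y ⊎ x ≈ y

  UpperBound : Pred Carrier 0ℓ → Pred Carrier 0ℓ
  UpperBound S b = ∀ {x} → x ∈ S → x ≤ b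

  field
    complete : ∀ (S : Pred Carrier 0ℓ) → Satisfiable S → Satisfiable (UpperBound S) →
               ∃[ s ] UpperBound S s × (∀ {b} → UpperBound S b → s ≤ b)

  module <-order = IsStrictTotalOrder isStrictTotalOrder

  ½ : Carrier
  ½ = (1# + 1#) ⁻¹

  partialSum : (ℕ → Carrier) → ℕ → Carrier
  partialSum a n = sum {n} (λ i → a (toℕ i))
    where open import Algebra.Properties.Monoid.Sum +-monoid using (sum)

  ConvergesTo : (ℕ → Carrier) → Carrier → Set
  ConvergesTo a l = ∀ ε → 0# < ε →
    ∃[ N ] (∀ n → N ℕ.≤ n → l - ε < a n × a n < l + ε)

record Topology (X : Set) : Set₂ where
  field
    IsOpen : Pred (Pred X 0ℓ) (suc 0ℓ)
    resp-≐ : ∀ {A B} → A ≐ B → IsOpen A → IsOpen B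
    full   : IsOpen U
    inter  : ∀ {A B} → IsOpen A → IsOpen B → IsOpen (A ∩ B)
    union  : ∀ {I : Set} (A : I → Pred X 0ℓ) → (∀ i → IsOpen (A i)) → IsOpen (⋃ I A)

-- Subsets are predicates, so equality of subsets is _≐_.
record SigmaAlgebra (X : Set) : Set₂ where
  field
    Measurable : Pred (Pred X 0ℓ) (suc 0ℓ)
    resp-≐     : ∀ {A B} → A ≐ B → Measurable A → Measurable B
    empty      : Measurable ∅
    compl      : ∀ {A} → Measurable A → Measurable (∁ A)
    union      : ∀ (A : ℕ → Pred X 0ℓ) → (∀ n → Measurable (A n)) → Measurable (⋃ ℕ A)

open SigmaAlgebra using (Measurable)

data Generated {X : Set} (G : Pred (Pred X 0ℓ) (suc 0ℓ)) : Pred (Pred X 0ℓ) (suc 0ℓ) where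
  basic  : ∀ {A} → G A → Generated G A
  resp-≐ : ∀ {A B} → A ≐ B → Generated G A → Generated G B
  empty  : Generated G ∅
  compl  : ∀ {A} → Generated G A → Generated G (∁ A)
  union  : ∀ (A : ℕ → Pred X 0ℓ) → (∀ n → Generated G (A n)) → Generated G (⋃ ℕ A)

generate : {X : Set} → Pred (Pred X 0ℓ) (suc 0ℓ) → SigmaAlgebra X
generate G = record
  { Measurable = Generated G ; resp-≐ = resp-≐ ; empty = empty ; compl = compl ; union = union }

Borel : {X : Set} → Topology X → SigmaAlgebra X
Borel τ = generate (Topology.IsOpen τ)

infixr 2 _⊗_
_⊗_ : {X Y : Set} → SigmaAlgebra X → SigmaAlgebra Y → SigmaAlgebra (X × Y)
𝓐 ⊗ 𝓑 = generate λ S →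
  ∃₂ λ A B → Measurable 𝓐 A × Measurable 𝓑 B × (S ≐ (A ⟨×⟩ B))

MeasurableFun : {X Y : Set} → SigmaAlgebra X → SigmaAlgebra Y → Pred (X → Y) (suc 0ℓ)
MeasurableFun 𝓐 𝓑 f = ∀ {B} → Measurable 𝓑 B → Measurable 𝓐 (f ⊢ B)

module _ (ℝ : Reals) where
  open Reals ℝ

  record OpenInℝ (A : Pred Carrier 0ℓ) : Set₁ where
    constructor isOpen
    field
      interval : ∀ {x} → x ∈ A →
        ∃₂ λ a b → a < x × x < b × (∀ {y} → a < y → y < b → y ∈ A)

  private
    -1< : ∀ x → x - 1# < x
    -1< x = <-order.<-respˡ-≈ (trans (+-comm 0# _) (+-identityʳ _))
      (<-order.<-respʳ-≈ (trans (+-comm 1# _) (trans (+-assoc x _ _)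
        (trans (+-congˡ (-‿inverseˡ 1#)) (+-identityʳ x))))
        (+-monoˡ-< (x - 1#) 0<1))

    <+1 : ∀ x → x < 1# + x
    <+1 x = <-order.<-respˡ-≈ (+-identityˡ x) (+-monoˡ-< x 0<1)

    max : ∀ {x} a a′ → a < x → a′ < x →
          ∃[ c ] c < x × (∀ {y} → c < y → a < y × a′ < y)
    max a a′ a<x a′<x with <-order.compare a a′
    ... | tri< a<a′ _ _ = a′ , a′<x , λ p → <-order.trans a<a′ p , p
    ... | tri≈ _ a≈a′ _ = a , a<x , λ p → p , <-order.<-respˡ-≈ a≈a′ p
    ... | tri> _ _ a′<a = a , a<x , λ p → p , <-order.trans a′<a p

    min : ∀ {x} b b′ → x < b → x < b′ →
          ∃[ c ] x < c × (∀ {y} → y < c → y < b × y < b′)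
    min b b′ x<b x<b′ with <-order.compare b b′
    ... | tri< b<b′ _ _ = b , x<b , λ p → p , <-order.trans p b<b′
    ... | tri≈ _ b≈b′ _ = b , x<b , λ p → p , <-order.<-respʳ-≈ b≈b′ p
    ... | tri> _ _ b′<b = b′ , x<b′ , λ p → <-order.trans p b′<b , p

  ℝ-topology : Topology Carrier
  ℝ-topology = record
    { IsOpen = OpenInℝ
    ; resp-≐ = λ (A⊆B , B⊆A) (isOpen o) → isOpen λ x∈B →
        let a , b , a<x , x<b , sub = o (B⊆A x∈B)
        in  a , b , a<x , x<b , λ p q → A⊆B (sub p q)
    ; full   = isOpen λ {x} _ → x - 1# , 1# + x , -1< x , <+1 x , λ _ _ → _
    ; inter  = λ (isOpen o) (isOpen o′) → isOpen λ (x∈A , x∈B) →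
        let a , b , a<x , x<b , sub      = o x∈A
            a′ , b′ , a′<x , x<b′ , sub′ = o′ x∈B
            c , c<x , below = max a a′ a<x a′<x
            d , x<d , above = min b b′ x<b x<b′
        in  c , d , c<x , x<d , λ p q →
              sub (proj₁ (below p)) (proj₁ (above q)) ,
              sub′ (proj₂ (below p)) (proj₂ (above q))
    ; union  = λ A o → isOpen λ (i , x∈Aᵢ) →
        let a , b , a<x , x<b , sub = OpenInℝ.interval (o i) x∈Aᵢ
        in  a , b , a<x , x<b , λ p q → i , sub p q
    }

  record Measure {X : Set} (𝓐 : SigmaAlgebra X) : Set₁ where
    module 𝓐 = SigmaAlgebra 𝓐
    field
      μ          : (A : Pred X 0ℓ) → Measurable 𝓐 A → Carrier
      μ-cong     : ∀ {A B} mA mB → A ≐ B → μ A mA ≈ μ B mB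
      nonneg     : ∀ {A} mA → 0# ≤ μ A mA
      μ-∅        : μ ∅ 𝓐.empty ≈ 0#
      σ-additive : ∀ (A : ℕ → Pred X 0ℓ) (mA : ∀ n → Measurable 𝓐 (A n)) →
                   (∀ m n → m ≢ n → Empty (A m ∩ A n)) →
                   ConvergesTo (partialSum (λ n → μ (A n) (mA n))) (μ (⋃ ℕ A) (𝓐.union A mA))

    -- A measurable set is null in this sense iff its measure is 0.
    Null : Pred (Pred X 0ℓ) (suc 0ℓ)
    Null S = ∃₂ λ N mN → S ⊆ N × μ N mN ≈ 0#

    AE : Pred (Pred X 0ℓ) (suc 0ℓ)
    AE P = Null (∁ P)

    IsProbability : Set₁
    IsProbability = ∀ m → μ U m ≈ 1#

    Atomless : Set₁
    Atomless = ∀ {A} mA → 0# < μ A mA →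
               ∃₂ λ B mB → B ⊆ A × 0# < μ B mB × μ B mB < μ A mA

  -- The topology is arbitrary; standard Borel spaces are the case of a Polish one.
  record AtomlessBorelProbabilitySpace : Set₂ where
    field
      Ω        : Set
      topology : Topology Ω

    𝓑 : SigmaAlgebra Ω
    𝓑 = Borel topology

    field
      ν             : Measure 𝓑
      isProbability : Measure.IsProbability ν
      atomless      : Measure.Atomless ν

  -- For probability measures this property determines the product measure on
  -- 𝓐 ⊗ 𝓐 uniquely, and such a measure always exists.
  IsProductSquare : {X : Set} {𝓐 : SigmaAlgebra X} → Measure 𝓐 → Measure (𝓐 ⊗ 𝓐) → Set₁
  IsProductSquare ν ν² = ∀ {A B} mA mB mA×B →
    Measure.μ ν² (A ⟨×⟩ B) mA×B ≈ Measure.μ ν A mA * Measure.μ ν B mB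

  module _ (𝛀 : AtomlessBorelProbabilitySpace) where
    open AtomlessBorelProbabilitySpace 𝛀
    open Measure ν using (AE)

    record Graphon : Set₁ where
      field
        W          : Ω × Ω → Carrier
        measurable : MeasurableFun (𝓑 ⊗ 𝓑) (Borel ℝ-topology) W
        symmetric  : ∀ x y → W (x , y) ≈ W (y , x)
        0≤W        : ∀ p → 0# ≤ W p
        W≤1        : ∀ p → W p ≤ 1#

      supp : Pred (Ω × Ω) 0ℓ
      supp p = 0# < W p

    -- Representatives; equality in L^∞(Ω) is _≈∞_.
    record L∞ : Set₁ where
      field
        fun        : Ω → Carrier
        measurable : MeasurableFun 𝓑 (Borel ℝ-topology) fun
        bounded    : ∃[ M ] AE (λ x → - M ≤ fun x × fun x ≤ M)

    open L∞ using (fun)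

    infix 4 _≈∞_
    _≈∞_ : Rel L∞ (suc 0ℓ)
    f ≈∞ g = AE λ x → fun f x ≈ fun g x

    -- c = ½ (c′ + c″) in L^∞(Ω).
    IsMidpoint : L∞ → L∞ → L∞ → Set₁
    IsMidpoint c c′ c″ = AE λ x → fun c x ≈ ½ * (fun c′ x + fun c″ x)

    IsExtreme : Pred L∞ (suc 0ℓ) → Pred L∞ (suc 0ℓ)
    IsExtreme 𝓧 c = c ∈ 𝓧 ×
      (∀ c′ c″ → c′ ∈ 𝓧 → c″ ∈ 𝓧 → IsMidpoint c c′ c″ → c′ ≈∞ c × c″ ≈∞ c)

    FCOV : Measure (𝓑 ⊗ 𝓑) → Graphon → Pred L∞ (suc 0ℓ)
    FCOV ν² W c =
      AE (λ x → 0# ≤ fun c x × fun c x ≤ 1#) ×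
      Measure.Null ν² (Graphon.supp W ∩ ∁ (λ (x , y) → 1# ≤ fun c x + fun c y))

    HalfIntegral : Pred L∞ (suc 0ℓ)
    HalfIntegral c = AE λ x → fun c x ≈ 0# ⊎ fun c x ≈ ½ ⊎ fun c x ≈ 1#

{-# OPTIONS --safe #-}
module Submission where

-- If 𝔠 is a fractional vertex cover, then so are lower ∘ 𝔠 and upper ∘ 𝔠, where
--   lower t = min 1 (max 0 (2t − ½))   and   upper t = max (min 2t ½) (2t − 1).
-- On [0,1] both maps are nondecreasing and symmetric about ½, which is why they
-- preserve the condition s + t ≥ 1. Since lower t + upper t = 2t, the cover 𝔠 is
-- the midpoint of the two, so extremality gives lower ∘ 𝔠 = 𝔠 almost everywhere,
-- and the only fixed points of lower are 0, ½ and 1.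

open import Defs
open import Axiom.ExcludedMiddle using (ExcludedMiddle)
open import Relation.Unary using (_∈_)

open import Data.Product.Base using (_×_; _,_; proj₁; proj₂)
open import Data.Sum.Base using (_⊎_; inj₁; inj₂)
open import Function.Base using (_∘_; const)
open import Level using (0ℓ)
open import Relation.Binary.Bundles using (DecTotalOrder; StrictTotalOrder)
open import Relation.Binary.Definitions using (tri<; tri≈; tri>)
open import Relation.Nullary.Negation using (contradiction; contraposition)
open import Relation.Unary using (Pred; _⊆_; _∪_; _⊢_)

-- Order arithmetic in the reals, and halving.

module OrderedField (ℝ : Reals) where
  open Reals ℝ

  strictTotalOrder : StrictTotalOrder 0ℓ 0ℓ 0ℓ
  strictTotalOrder = record { isStrictTotalOrder = isStrictTotalOrder }

  open import Relation.Binary.Properties.StrictTotalOrder strictTotalOrder public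
    using (decTotalOrder)
  open DecTotalOrder decTotalOrder public
    using (totalOrder)
    renaming (refl to ≤-refl; reflexive to ≤-reflexive; trans to ≤-trans)

  open import Algebra.Construct.NaturalChoice.Min totalOrder public
  open import Algebra.Construct.NaturalChoice.Max totalOrder public
  open import Algebra.Properties.Group +-group public
    using (//-rightDividesˡ; //-rightDividesʳ; ∙-cancelʳ)
  open import Relation.Binary.Reasoning.StrictPartialOrder
    (StrictTotalOrder.strictPartialOrder strictTotalOrder) public

  -- Abstract, so that a with-abstraction over it does not reach into _⊓_ and _⊔_.
  abstract
    ≤-total : ∀ x y → x ≤ y ⊎ y ≤ x
    ≤-total = DecTotalOrder.total decTotalOrder

  +-mono-< : ∀ {x y z w} → x < y → z < w → x + z < y + w
  +-mono-< {x} {y} {z} {w} x<y z<w = begin-strict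
    x + z  <⟨ +-monoˡ-< z x<y ⟩
    y + z  ≈⟨ +-comm y z ⟩
    z + y  <⟨ +-monoˡ-< y z<w ⟩
    w + y  ≈⟨ +-comm w y ⟩
    y + w  ∎

  +-monoˡ-≤ : ∀ {x y} z → x ≤ y → x + z ≤ y + z
  +-monoˡ-≤ z (inj₁ x<y) = inj₁ (+-monoˡ-< z x<y)
  +-monoˡ-≤ z (inj₂ x≈y) = inj₂ (+-congʳ x≈y)

  +-mono-≤ : ∀ {x y z w} → x ≤ y → z ≤ w → x + z ≤ y + w
  +-mono-≤ {x} {y} {z} {w} x≤y z≤w = begin
    x + z  ≤⟨ +-monoˡ-≤ z x≤y ⟩
    y + z  ≈⟨ +-comm y z ⟩
    z + y  ≤⟨ +-monoˡ-≤ y z≤w ⟩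
    w + y  ≈⟨ +-comm w y ⟩
    y + w  ∎

  x<y+z⇒x-z<y : ∀ {x y z} → x < y + z → x - z < y
  x<y+z⇒x-z<y {x} {y} {z} p =
    <-order.<-respʳ-≈ (//-rightDividesʳ z y) (+-monoˡ-< (- z) p)

  x+z<y⇒x<y-z : ∀ {x y z} → x + z < y → x < y - z
  x+z<y⇒x<y-z {x} {y} {z} p =
    <-order.<-respˡ-≈ (//-rightDividesʳ z x) (+-monoˡ-< (- z) p)

  x-z<y⇒x<y+z : ∀ {x y z} → x - z < y → x < y + z
  x-z<y⇒x<y+z {x} {y} {z} p =
    <-order.<-respˡ-≈ (//-rightDividesˡ z x) (+-monoˡ-< z p)

  x<y-z⇒x+z<y : ∀ {x y z} → x < y - z → x + z < y
  x<y-z⇒x+z<y {x} {y} {z} p =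
    <-order.<-respʳ-≈ (//-rightDividesˡ z y) (+-monoˡ-< z p)

  x≤y+z⇒x-z≤y : ∀ {x y z} → x ≤ y + z → x - z ≤ y
  x≤y+z⇒x-z≤y {x} {y} {z} p = begin
    x - z        ≤⟨ +-monoˡ-≤ (- z) p ⟩
    (y + z) - z  ≈⟨ //-rightDividesʳ z y ⟩
    y            ∎

  x+z≤y⇒x≤y-z : ∀ {x y z} → x + z ≤ y → x ≤ y - z
  x+z≤y⇒x≤y-z {x} {y} {z} p = begin
    x            ≈⟨ //-rightDividesʳ z x ⟨
    (x + z) - z  ≤⟨ +-monoˡ-≤ (- z) p ⟩
    y - z        ∎

  +-cancelʳ-≤ : ∀ {x y} z → x + z ≤ y + z → x ≤ y
  +-cancelʳ-≤ {x} {y} z p = ≤-trans (x+z≤y⇒x≤y-z p) (≤-reflexive (//-rightDividesʳ z y))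

  x-z≤y⇒x≤y+z : ∀ {x y z} → x - z ≤ y → x ≤ y + z
  x-z≤y⇒x≤y+z {x} {y} {z} p = begin
    x            ≈⟨ //-rightDividesˡ z x ⟨
    (x - z) + z  ≤⟨ +-monoˡ-≤ z p ⟩
    y + z        ∎

  x≤y-z⇒x+z≤y : ∀ {x y z} → x ≤ y - z → x + z ≤ y
  x≤y-z⇒x+z≤y {x} {y} {z} p = begin
    x + z        ≤⟨ +-monoˡ-≤ z p ⟩
    (y - z) + z  ≈⟨ //-rightDividesˡ z y ⟩
    y            ∎

  -- Doubling is strictly increasing, so trichotomy leaves only `x < y`. This lets one compare
  -- against halves without dividing.
  double-cancel-< : ∀ {x y} → x + x < y + y → x < y
  double-cancel-< {x} {y} p with <-order.compare x y
  ... | tri< x<y _ _ = x<y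
  ... | tri≈ _ x≈y _ = contradiction p (<-order.irrefl (+-cong x≈y x≈y))
  ... | tri> _ _ y<x = contradiction p (<-order.asym (+-mono-< y<x y<x))

  0<1+1 : 0# < 1# + 1#
  0<1+1 = begin-strict
    0#       ≈⟨ +-identityˡ 0# ⟨
    0# + 0#  <⟨ +-mono-< 0<1 0<1 ⟩
    1# + 1#  ∎

  -- The one place where the inverse defining `½` is unfolded; it needs `1# + 1#` to be nonzero,
  -- which follows from positivity. Every later fact about `½` rests on this.
  ½*x+½*x≈x : ∀ x → ½ * x + ½ * x ≈ x
  ½*x+½*x≈x x = begin-equality
    ½ * x + ½ * x      ≈⟨ distribʳ x ½ ½ ⟨
    (½ + ½) * x        ≈⟨ *-congʳ (+-cong (*-identityˡ ½) (*-identityˡ ½)) ⟨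
    (1# * ½ + 1# * ½) * x ≈⟨ *-congʳ (distribʳ ½ 1# 1#) ⟨
    ((1# + 1#) * ½) * x ≈⟨ *-congʳ (*-inverseʳ _ λ p → <-order.irrefl (sym p) 0<1+1) ⟩
    1# * x             ≈⟨ *-identityˡ x ⟩
    x                  ∎

  ½+½≈1 : ½ + ½ ≈ 1#
  ½+½≈1 = begin-equality
    ½ + ½            ≈⟨ +-cong (*-identityʳ ½) (*-identityʳ ½) ⟨
    ½ * 1# + ½ * 1#  ≈⟨ ½*x+½*x≈x 1# ⟩
    1#               ∎

  ½*[x+x]≈x : ∀ x → ½ * (x + x) ≈ x
  ½*[x+x]≈x x = trans (distribˡ ½ x x) (½*x+½*x≈x x)

  0<½ : 0# < ½
  0<½ = double-cancel-< (begin-strict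
    0# + 0#  ≈⟨ +-identityˡ 0# ⟩
    0#       <⟨ 0<1 ⟩
    1#       ≈⟨ ½+½≈1 ⟨
    ½ + ½    ∎)

  ½<1 : ½ < 1#
  ½<1 = double-cancel-< (begin-strict
    ½ + ½    ≈⟨ ½+½≈1 ⟩
    1#       ≈⟨ +-identityˡ 1# ⟨
    0# + 1#  <⟨ +-monoˡ-< 1# 0<1 ⟩
    1# + 1#  ∎)

  -1≤0 : - 1# ≤ 0#
  -1≤0 = begin
    - 1#      ≈⟨ +-identityˡ (- 1#) ⟨
    0# - 1#   ≤⟨ x≤y+z⇒x-z≤y (inj₁ (<-order.<-respʳ-≈ (sym (+-identityˡ 1#)) 0<1)) ⟩
    0#        ∎

  -- The two piecewise linear maps and their covering properties.

  lower : Carrier → Carrier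
  lower t = 1# ⊓ (0# ⊔ ((t + t) - ½))

  upper : Carrier → Carrier
  upper t = ((t + t) ⊓ ½) ⊔ ((t + t) - 1#)

  0≤lower : ∀ t → 0# ≤ lower t
  0≤lower t = ⊓-glb (inj₁ 0<1) (x≤x⊔y _ _)

  lower≤1 : ∀ t → lower t ≤ 1#
  lower≤1 t = x⊓y≤x _ _

  0≤upper : ∀ {t} → 0# ≤ t → 0# ≤ upper t
  0≤upper {t} 0≤t = ≤-trans (⊓-glb 0≤t+t (inj₁ 0<½)) (x≤x⊔y _ _)
    where
    0≤t+t : 0# ≤ t + t
    0≤t+t = ≤-trans (≤-reflexive (sym (+-identityˡ 0#))) (+-mono-≤ 0≤t 0≤t)

  upper≤1 : ∀ {t} → t ≤ 1# → upper t ≤ 1#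
  upper≤1 {t} t≤1 =
    ⊔-lub (≤-trans (x⊓y≤y _ _) (inj₁ ½<1)) (x≤y+z⇒x-z≤y (+-mono-≤ t≤1 t≤1))

  -- Here `p` and `q` are affine pieces of the map at `s` and `t`, with sum 2(s + t) - 1, which is
  -- at least 1 once s + t is. Adding `1#` to both sides keeps subtraction out of the hypothesis.
  double-cover : ∀ {s t p q} → p + q + 1# ≈ (s + s) + (t + t) → 1# ≤ s + t → 1# ≤ p + q
  double-cover {s} {t} {p} {q} eq 1≤s+t = +-cancelʳ-≤ 1# (begin
    1# + 1#            ≤⟨ +-mono-≤ 1≤s+t 1≤s+t ⟩
    (s + t) + (s + t)  ≈⟨ interchange s t s t ⟩
    (s + s) + (t + t)  ≈⟨ eq ⟨
    p + q + 1#         ∎)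
    where open import Algebra.Properties.CommutativeSemigroup +-commutativeSemigroup

  -- If one value is capped at 1, nonnegativity of the other suffices. If neither is, they dominate
  -- 2s - ½ and 2t - ½, and the two halves lost add up to 1.
  lower-cover : ∀ {s t} → 1# ≤ s + t → 1# ≤ lower s + lower t
  lower-cover {s} {t} 1≤s+t
    with ⊓-sel 1# (0# ⊔ ((s + s) - ½)) | ⊓-sel 1# (0# ⊔ ((t + t) - ½))
  ... | inj₁ ls≈1 | _ = begin
    1#                 ≈⟨ +-identityʳ 1# ⟨
    1# + 0#            ≤⟨ +-mono-≤ (≤-reflexive (sym ls≈1)) (0≤lower t) ⟩
    lower s + lower t  ∎
  ... | inj₂ _ | inj₁ lt≈1 = begin
    1#                 ≈⟨ +-identityˡ 1# ⟨
    0# + 1#            ≤⟨ +-mono-≤ (0≤lower s) (≤-reflexive (sym lt≈1)) ⟩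
    lower s + lower t  ∎
  ... | inj₂ ls≈ | inj₂ lt≈ = begin
    1#                                ≤⟨ double-cover eq 1≤s+t ⟩
    ((s + s) - ½) + ((t + t) - ½)     ≤⟨ +-mono-≤ (x≤y⊔x 0# _) (x≤y⊔x 0# _) ⟩
    (0# ⊔ ((s + s) - ½)) + (0# ⊔ ((t + t) - ½)) ≈⟨ +-cong ls≈ lt≈ ⟨
    lower s + lower t                 ∎
    where
    open import Algebra.Properties.CommutativeSemigroup +-commutativeSemigroup
    eq : ((s + s) - ½) + ((t + t) - ½) + 1# ≈ (s + s) + (t + t)
    eq = begin-equality
      ((s + s) - ½) + ((t + t) - ½) + 1#           ≈⟨ +-congˡ ½+½≈1 ⟨
      ((s + s) - ½) + ((t + t) - ½) + (½ + ½)      ≈⟨ interchange _ _ _ _ ⟩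
      (((s + s) - ½) + ½) + (((t + t) - ½) + ½)
        ≈⟨ +-cong (//-rightDividesˡ ½ _) (//-rightDividesˡ ½ _) ⟩
      (s + s) + (t + t)                            ∎

  -- For small t the value at t is at least 2t, while the value at s is always at least 2s - 1.
  upper-cover-2t≤½ : ∀ {s t} → t + t ≤ ½ → 1# ≤ s + t → 1# ≤ upper s + upper t
  upper-cover-2t≤½ {s} {t} 2t≤½ 1≤s+t = begin
    1#                        ≤⟨ double-cover eq 1≤s+t ⟩
    ((s + s) - 1#) + (t + t)  ≤⟨ +-mono-≤ (x≤y⊔x _ _) 2t≤upper ⟩
    upper s + upper t         ∎
    where
    open import Algebra.Properties.CommutativeSemigroup +-commutativeSemigroup
    2t≤upper : t + t ≤ upper t
    2t≤upper = ≤-trans (⊓-glb ≤-refl 2t≤½) (x≤x⊔y _ _)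
    eq : ((s + s) - 1#) + (t + t) + 1# ≈ (s + s) + (t + t)
    eq = trans (xy∙z≈xz∙y _ _ _) (+-congʳ (//-rightDividesˡ 1# _))

  -- If either doubled argument is at most ½, the previous lemma applies, up to swapping s and t.
  -- Otherwise both values have reached the plateau at ½.
  upper-cover : ∀ {s t} → 1# ≤ s + t → 1# ≤ upper s + upper t
  upper-cover {s} {t} 1≤s+t with ≤-total (t + t) ½ | ≤-total (s + s) ½
  ... | inj₁ 2t≤½ | _ = upper-cover-2t≤½ 2t≤½ 1≤s+t
  ... | inj₂ _ | inj₁ 2s≤½ = begin
    1#                 ≤⟨ upper-cover-2t≤½ 2s≤½ (≤-trans 1≤s+t (≤-reflexive (+-comm s t))) ⟩
    upper t + upper s  ≈⟨ +-comm _ _ ⟩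
    upper s + upper t  ∎
  ... | inj₂ ½≤2t | inj₂ ½≤2s = begin
    1#                 ≈⟨ ½+½≈1 ⟨
    ½ + ½              ≤⟨ +-mono-≤ (½≤upper ½≤2s) (½≤upper ½≤2t) ⟩
    upper s + upper t  ∎
    where
    ½≤upper : ∀ {r} → ½ ≤ r + r → ½ ≤ upper r
    ½≤upper ½≤2r = ≤-trans (⊓-glb ½≤2r ≤-refl) (x≤x⊔y _ _)

  -- The breakpoints are t = ¼ and t = ¾, found by comparing u = 2t - ½ with 0 and 1. On the three
  -- pieces the pair of values is (0, 2t), (2t - ½, ½) and (1, 2t - 1). In the local names, `v`
  -- stands for 2t - 1.
  lower+upper : ∀ t → lower t + upper t ≈ t + t
  lower+upper t with ≤-total ((t + t) - ½) 0#
  ... | inj₁ u≤0 = begin-equality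
    lower t + upper t  ≈⟨ +-cong lower≈0 upper≈2t ⟩
    0# + (t + t)       ≈⟨ +-identityˡ _ ⟩
    t + t              ∎
    where
    2t≤½ : t + t ≤ ½
    2t≤½ = ≤-trans (x-z≤y⇒x≤y+z u≤0) (≤-reflexive (+-identityˡ ½))
    lower≈0 : lower t ≈ 0#
    lower≈0 = trans (⊓-congˡ 1# (x≤y⇒y⊔x≈y u≤0)) (x≤y⇒y⊓x≈x (inj₁ 0<1))
    v≤2t : (t + t) - 1# ≤ t + t
    v≤2t = x≤y+z⇒x-z≤y (≤-trans (≤-reflexive (sym (+-identityʳ _)))
             (+-mono-≤ ≤-refl (inj₁ 0<1)))
    upper≈2t : upper t ≈ t + t
    upper≈2t = trans (⊔-congʳ _ (x≤y⇒x⊓y≈x 2t≤½)) (x≤y⇒y⊔x≈y v≤2t)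
  ... | inj₂ 0≤u with ≤-total ((t + t) - ½) 1#
  ...   | inj₁ u≤1 = begin-equality
    lower t + upper t    ≈⟨ +-cong lower≈u upper≈½ ⟩
    ((t + t) - ½) + ½    ≈⟨ //-rightDividesˡ ½ _ ⟩
    t + t                ∎
    where
    ½≤2t : ½ ≤ t + t
    ½≤2t = ≤-trans (≤-reflexive (sym (+-identityˡ ½))) (x≤y-z⇒x+z≤y 0≤u)
    lower≈u : lower t ≈ (t + t) - ½
    lower≈u = trans (⊓-congˡ 1# (x≤y⇒x⊔y≈y 0≤u)) (x≤y⇒y⊓x≈x u≤1)
    v≤½ : (t + t) - 1# ≤ ½
    v≤½ = x≤y+z⇒x-z≤y (≤-trans (x-z≤y⇒x≤y+z u≤1) (≤-reflexive (+-comm 1# ½)))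
    upper≈½ : upper t ≈ ½
    upper≈½ = trans (⊔-congʳ _ (x≤y⇒y⊓x≈x ½≤2t)) (x≤y⇒y⊔x≈y v≤½)
  ...   | inj₂ 1≤u = begin-equality
    lower t + upper t      ≈⟨ +-cong lower≈1 upper≈v ⟩
    1# + ((t + t) - 1#)    ≈⟨ +-comm _ _ ⟩
    ((t + t) - 1#) + 1#    ≈⟨ //-rightDividesˡ 1# _ ⟩
    t + t                  ∎
    where
    lower≈1 : lower t ≈ 1#
    lower≈1 = x≤y⇒x⊓y≈x (≤-trans 1≤u (x≤y⊔x _ _))
    ½≤v : ½ ≤ (t + t) - 1#
    ½≤v = x+z≤y⇒x≤y-z (≤-trans (≤-reflexive (+-comm ½ 1#)) (x≤y-z⇒x+z≤y 1≤u))
    upper≈v : upper t ≈ (t + t) - 1#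
    upper≈v = x≤y⇒x⊔y≈y (≤-trans (x⊓y≤y _ _) ½≤v)

  midpoint-lower-upper : ∀ t → t ≈ ½ * (lower t + upper t)
  midpoint-lower-upper t = sym (trans (*-congˡ (lower+upper t)) (½*[x+x]≈x t))

  -- A fixed point lies on one of three affine branches: the constant ones give 1 and 0, and 2t - ½
  -- = t gives ½.
  lower-fixed : ∀ {t} → lower t ≈ t → t ≈ 0# ⊎ t ≈ ½ ⊎ t ≈ 1#
  lower-fixed {t} fix with ⊓-sel 1# (0# ⊔ ((t + t) - ½))
  ... | inj₁ l≈1 = inj₂ (inj₂ (trans (sym fix) l≈1))
  ... | inj₂ l≈m with ⊔-sel 0# ((t + t) - ½)
  ...   | inj₁ m≈0 = inj₁ (trans (sym fix) (trans l≈m m≈0))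
  ...   | inj₂ m≈u = inj₂ (inj₁ (sym (∙-cancelʳ t ½ t (begin-equality
    ½ + t                ≈⟨ +-comm ½ t ⟩
    t + ½                ≈⟨ +-congʳ (trans (sym fix) (trans l≈m m≈u)) ⟩
    ((t + t) - ½) + ½    ≈⟨ //-rightDividesˡ ½ _ ⟩
    t + t                ∎))))

-- Continuity, and hence Borel measurability, of the two maps.

module Continuity (ℝ : Reals) where
  open Reals ℝ
  open OrderedField ℝ

  Open : Pred (Pred Carrier 0ℓ) _
  Open = OpenInℝ ℝ

  open Topology (ℝ-topology ℝ) using (full; inter) renaming (resp-≐ to open-resp-≐)

  open-∪ : ∀ {A B} → Open A → Open B → Open (A ∪ B)
  open-∪ (isOpen oA) (isOpen oB) = isOpen λ where
    (inj₁ x∈A) → let a , b , a<x , x<b , sub = oA x∈A in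
      a , b , a<x , x<b , λ p q → inj₁ (sub p q)
    (inj₂ x∈B) → let a , b , a<x , x<b , sub = oB x∈B in
      a , b , a<x , x<b , λ p q → inj₂ (sub p q)

  open-const : ∀ (P : Set) → Open (λ _ → P)
  open-const P = isOpen λ p →
    let a , b , a<x , x<b , _ = OpenInℝ.interval full _ in
    a , b , a<x , x<b , λ _ _ → p

  -- An interval needs two endpoints; `full` supplies one on the unbounded side.
  open-< : ∀ b → Open (_< b)
  open-< b = isOpen λ {x} x<b →
    let a , _ , a<x , _ , _ = OpenInℝ.interval full {x} _ in
    a , b , a<x , x<b , λ _ q → q

  open-> : ∀ a → Open (a <_)
  open-> a = isOpen λ {x} a<x →
    let _ , b , _ , x<b , _ = OpenInℝ.interval full {x} _ in
    a , b , a<x , x<b , λ p _ → p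

  -- Open rays form a subbase of the topology, so this is ordinary continuity. Rays are convenient
  -- because minima and maxima turn them into unions and intersections.
  record RayContinuous (f : Carrier → Carrier) : Set₁ where
    field
      below : ∀ b → Open (λ x → f x < b)
      above : ∀ a → Open (λ x → a < f x)

  open RayContinuous

  preimage-open : ∀ {f A} → RayContinuous f → Open A → Open (f ⊢ A)
  preimage-open c (isOpen o) = isOpen λ fx∈A →
    let a , b , a<fx , fx<b , sub = o fx∈A
        -- The interval from `a` to `b` is the intersection of two rays, so the two open preimages
        -- of these rays meet in a neighbourhood of the point.
        a′ , b′ , a′<x , x<b′ , sub′ =
          OpenInℝ.interval (inter (above c a) (below c b)) (a<fx , fx<b)
    in a′ , b′ , a′<x , x<b′ , λ p q → let r , s = sub′ p q in sub r s

  -- Induction on how the Borel set is generated: preimages commute with complements and countable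
  -- unions, so only open sets need continuity.
  measurable : ∀ {f} → RayContinuous f →
               MeasurableFun (Borel (ℝ-topology ℝ)) (Borel (ℝ-topology ℝ)) f
  measurable c (basic o)              = basic (preimage-open c o)
  measurable c (resp-≐ (A⊆B , B⊆A) m) = resp-≐ (A⊆B , B⊆A) (measurable c m)
  measurable c empty                  = empty
  measurable c (compl m)              = compl (measurable c m)
  measurable c (union A m)            = union _ (λ n → measurable c (m n))

  const-cont : ∀ k → RayContinuous (const k)
  const-cont k .below b = open-const (k < b)
  const-cont k .above a = open-const (a < k)

  double-cont : RayContinuous (λ x → x + x)
  double-cont .below b = open-resp-≐ (to , from) (open-< (½ * b))
    where
    to : ∀ {x} → x < ½ * b → x + x < b
    to p = <-order.<-respʳ-≈ (½*x+½*x≈x b) (+-mono-< p p)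
    from : ∀ {x} → x + x < b → x < ½ * b
    from p = double-cancel-< (<-order.<-respʳ-≈ (sym (½*x+½*x≈x b)) p)
  double-cont .above a = open-resp-≐ (to , from) (open-> (½ * a))
    where
    to : ∀ {x} → ½ * a < x → a < x + x
    to p = <-order.<-respˡ-≈ (½*x+½*x≈x a) (+-mono-< p p)
    from : ∀ {x} → a < x + x → ½ * a < x
    from p = double-cancel-< (<-order.<-respˡ-≈ (sym (½*x+½*x≈x a)) p)

  shift-cont : ∀ {f} k → RayContinuous f → RayContinuous (λ x → f x - k)
  shift-cont k c .below b = open-resp-≐ (x<y+z⇒x-z<y , x-z<y⇒x<y+z) (below c (b + k))
  shift-cont k c .above a = open-resp-≐ (x+z<y⇒x<y-z , x<y-z⇒x+z<y) (above c (a + k))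

  -- A minimum is below `b` when one argument is, and above `a` when both are.
  ⊓-cont : ∀ {f g} → RayContinuous f → RayContinuous g → RayContinuous (λ x → f x ⊓ g x)
  ⊓-cont {f} {g} c d .below b = open-resp-≐ (to , from) (open-∪ (below c b) (below d b))
    where
    to : ∀ {x} → f x < b ⊎ g x < b → f x ⊓ g x < b
    to {x} (inj₁ p) = begin-strict f x ⊓ g x ≤⟨ x⊓y≤x _ _ ⟩ f x <⟨ p ⟩ b ∎
    to {x} (inj₂ p) = begin-strict f x ⊓ g x ≤⟨ x⊓y≤y _ _ ⟩ g x <⟨ p ⟩ b ∎
    from : ∀ {x} → f x ⊓ g x < b → f x < b ⊎ g x < b
    from {x} p with ⊓-sel (f x) (g x)
    ... | inj₁ e = inj₁ (<-order.<-respˡ-≈ e p)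
    ... | inj₂ e = inj₂ (<-order.<-respˡ-≈ e p)
  ⊓-cont {f} {g} c d .above a = open-resp-≐ (to , from) (inter (above c a) (above d a))
    where
    to : ∀ {x} → a < f x × a < g x → a < f x ⊓ g x
    to {x} (p , q) with ⊓-sel (f x) (g x)
    ... | inj₁ e = <-order.<-respʳ-≈ (sym e) p
    ... | inj₂ e = <-order.<-respʳ-≈ (sym e) q
    from : ∀ {x} → a < f x ⊓ g x → a < f x × a < g x
    from {x} p =
      (begin-strict a <⟨ p ⟩ f x ⊓ g x ≤⟨ x⊓y≤x _ _ ⟩ f x ∎) ,
      (begin-strict a <⟨ p ⟩ f x ⊓ g x ≤⟨ x⊓y≤y _ _ ⟩ g x ∎)

  ⊔-cont : ∀ {f g} → RayContinuous f → RayContinuous g → RayContinuous (λ x → f x ⊔ g x)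
  ⊔-cont {f} {g} c d .below b = open-resp-≐ (to , from) (inter (below c b) (below d b))
    where
    to : ∀ {x} → f x < b × g x < b → f x ⊔ g x < b
    to {x} (p , q) with ⊔-sel (f x) (g x)
    ... | inj₁ e = <-order.<-respˡ-≈ (sym e) p
    ... | inj₂ e = <-order.<-respˡ-≈ (sym e) q
    from : ∀ {x} → f x ⊔ g x < b → f x < b × g x < b
    from {x} p =
      (begin-strict f x ≤⟨ x≤x⊔y _ _ ⟩ f x ⊔ g x <⟨ p ⟩ b ∎) ,
      (begin-strict g x ≤⟨ x≤y⊔x _ _ ⟩ f x ⊔ g x <⟨ p ⟩ b ∎)
  ⊔-cont {f} {g} c d .above a = open-resp-≐ (to , from) (open-∪ (above c a) (above d a))
    where
    to : ∀ {x} → a < f x ⊎ a < g x → a < f x ⊔ g x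
    to {x} (inj₁ p) = begin-strict a <⟨ p ⟩ f x ≤⟨ x≤x⊔y _ _ ⟩ f x ⊔ g x ∎
    to {x} (inj₂ p) = begin-strict a <⟨ p ⟩ g x ≤⟨ x≤y⊔x _ _ ⟩ f x ⊔ g x ∎
    from : ∀ {x} → a < f x ⊔ g x → a < f x ⊎ a < g x
    from {x} p with ⊔-sel (f x) (g x)
    ... | inj₁ e = inj₁ (<-order.<-respʳ-≈ e p)
    ... | inj₂ e = inj₂ (<-order.<-respʳ-≈ e p)

  lower-cont : RayContinuous lower
  lower-cont = ⊓-cont (const-cont 1#) (⊔-cont (const-cont 0#) (shift-cont ½ double-cont))

  upper-cont : RayContinuous upper
  upper-cont = ⊔-cont (⊓-cont double-cont (const-cont ½)) (shift-cont 1# double-cont)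

-- Monotonicity of null sets and of almost-everywhere statements.

module _ (ℝ : Reals) {X : Set} {𝓐 : SigmaAlgebra X} (μ : Measure ℝ 𝓐) where
  open Measure μ using (Null; AE)

  Null-antimono : ∀ {S T} → S ⊆ T → Null T → Null S
  Null-antimono S⊆T (N , mN , T⊆N , μN≈0) = N , mN , T⊆N ∘ S⊆T , μN≈0

  AE-mono : ∀ {P Q} → P ⊆ Q → AE P → AE Q
  AE-mono P⊆Q = Null-antimono (contraposition P⊆Q)

-- Transforming a fractional cover by a map of its values.

module Covers (ℝ : Reals) (𝛀 : AtomlessBorelProbabilitySpace ℝ)
              (ν² : Measure ℝ (AtomlessBorelProbabilitySpace.𝓑 𝛀 ⊗ AtomlessBorelProbabilitySpace.𝓑 𝛀))
              (W : Graphon ℝ 𝛀) (𝔠 : L∞ ℝ 𝛀)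
              (𝔠∈FCOV : 𝔠 ∈ FCOV ℝ 𝛀 ν² W) where
  open Reals ℝ
  open OrderedField ℝ
  open Continuity ℝ using (RayContinuous)
  open AtomlessBorelProbabilitySpace 𝛀 using (ν)
  open L∞

  module _ {h : Carrier → Carrier} (h-cont : RayContinuous h)
           (h-bounds : ∀ {t} → 0# ≤ t × t ≤ 1# → 0# ≤ h t × h t ≤ 1#)
           (h-cover : ∀ {s t} → 1# ≤ s + t → 1# ≤ h s + h t) where

    compose : L∞ ℝ 𝛀
    compose .fun          = h ∘ fun 𝔠
    compose .measurable m = measurable 𝔠 (Continuity.measurable ℝ h-cont m)
    -- The bound is symmetric about 0, so values in [0,1] also have to be checked against -1.
    compose .bounded      = 1# , AE-mono ℝ ν
      (λ c∈[0,1] → let 0≤h , h≤1 = h-bounds c∈[0,1] in ≤-trans -1≤0 0≤h , h≤1)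
      (proj₁ 𝔠∈FCOV)

    compose∈FCOV : compose ∈ FCOV ℝ 𝛀 ν² W
    compose∈FCOV =
      AE-mono ℝ ν h-bounds (proj₁ 𝔠∈FCOV) ,
      -- A pair left uncovered after applying `h` was already uncovered by `𝔠`, so the exceptional
      -- set can only shrink.
      Null-antimono ℝ ν² (λ (W>0 , ¬cover) → W>0 , ¬cover ∘ h-cover) (proj₂ 𝔠∈FCOV)

theorem13 : (∀ {ℓ} → ExcludedMiddle ℓ) →
    (ℝ : Reals) (𝛀 : AtomlessBorelProbabilitySpace ℝ) →
    let open AtomlessBorelProbabilitySpace 𝛀 in
    (ν² : Measure ℝ (𝓑 ⊗ 𝓑)) → IsProductSquare ℝ ν ν² →
    (W : Graphon ℝ 𝛀) (𝔠 : L∞ ℝ 𝛀) →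
    𝔠 ∈ IsExtreme ℝ 𝛀 (FCOV ℝ 𝛀 ν² W) →
    𝔠 ∈ HalfIntegral ℝ 𝛀
theorem13 _ ℝ 𝛀 ν² _ W 𝔠 (𝔠∈FCOV , extreme) =
  AE-mono ℝ ν lower-fixed (proj₁ (extreme (compose lower-cont lower-bounds lower-cover)
    (compose upper-cont upper-bounds upper-cover)
    (compose∈FCOV lower-cont lower-bounds lower-cover)
    (compose∈FCOV upper-cont upper-bounds upper-cover)
    -- The midpoint identity holds at every point, so it follows by weakening any almost-everywhere
    -- statement, here the one on the range of `𝔠`.
    (AE-mono ℝ ν (λ _ → midpoint-lower-upper _) (proj₁ 𝔠∈FCOV))))
  where
  open Reals ℝ
  open AtomlessBorelProbabilitySpace 𝛀
  open OrderedField ℝ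
  open Continuity ℝ using (lower-cont; upper-cont)
  open Covers ℝ 𝛀 ν² W 𝔠 𝔠∈FCOV

  lower-bounds : ∀ {t} → 0# ≤ t × t ≤ 1# → 0# ≤ lower t × lower t ≤ 1#
  lower-bounds {t} _ = 0≤lower t , lower≤1 t

  upper-bounds : ∀ {t} → 0# ≤ t × t ≤ 1# → 0# ≤ upper t × upper t ≤ 1#
  upper-bounds (0≤t , t≤1) = 0≤upper 0≤t , upper≤1 t≤1
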